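{- Let $U$ be a nonempty set. For every MSO formula $\varphi$, deep validity and validity of the maximal-shallow translation coincide: $\models^d\varphi$ if and only if $\models^s\llbracket\varphi\rrbracket$.
   Context: **Syntax.** Relation symbols $R=\mathbb N$, first-order variables $V=\mathbb N$ and second-order (monadic) variables $V_2=\mathbb N$ (the two kinds of variables form separate namespaces). MSO formulas (an inductive datatype): $\varphi,\psi ::= r(x,y)\mid X(x)\mid\neg\varphi\mid\varphi\wedge\psi\mid\exists x.\varphi\mid\exists X.\varphi$ with $r\in R$, $x,y\in V$, $X\in V_2$ (no equality). **Deep semantics.** $U$ is a fixed nonempty set (the type of individuals). An interpretation $I$ over $U$ assigns to each $r\in R$ a binary relation $I(r)\subseteq U\times U$. Given $I$, $D\subseteq U$, $E\subseteq\mathcal P(U)$, $g:V\to U$, $G:V_2\to\mathcal P(U)$, truth $\langle I,D,E\rangle,g,G\models^d\varphi$ is defined recursively: $r(x,y)$ holds iff $(g(x),g(y))\in I(r)$; $X(x)$ holds iff $g(x)\in G(X)$; $\neg,\wedge$ are classical; $\exists x.\varphi$ holds iff $\langle I,D,E\rangle,g[x\leftarrow d],G\models^d\varphi$ for some $d\in D$; $\exists X.\varphi$ holds iff $\langle I,D,E\rangle,g,G\langle X\leftarrow S\rangle\models^d\varphi$ for some $S\in E$. Here $g[x\leftarrow d]$ is the assignment that maps $x$ to $d$ and agrees with $g$ elsewhere, and $G\langle X\leftarrow S\rangle$ is the assignment that maps $X$ to $S$ and agrees with $G$ elsewhere. $\models^d\varphi$ means: for all $I$, $D\subseteq U$, $E\subseteq\mathcal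 P(U)$, all $g$ with $\mathrm{Range}(g)\subseteq D$ and all $G$ with $\mathrm{Range}(G)\subseteq E$, $\langle I,D,E\rangle,g,G\models^d\varphi$. **Maximal-shallow embedding.** Let $\sigma$ be the set of all Boolean-valued functions of arguments $(I,D,E,g,G)$, where $I$ is an interpretation over $U$ (assigning to each $r\in R$ a binary relation $I(r)\subseteq U\times U$), $D\subseteq U$, $E\subseteq\mathcal P(U)$, $g:V\to U$ and $G:V_2\to\mathcal P(U)$. The shallow operations are: $r^s(x,y):=\lambda I\,D\,E\,g\,G.\ (g(x),g(y))\in I(r)$; $X^s(x):=\lambda I\,D\,E\,g\,G.\ g(x)\in G(X)$; $\neg^s a:=\lambda I\,D\,E\,g\,G.\ \neg a(I,D,E,g,G)$; $a\wedge^s b$ pointwise conjunction; $\exists^s x.a:=\lambda I\,D\,E\,g\,G.\ \exists d\in D.\ a(I,D,E,g[x\leftarrow d],G)$; $\exists^s_2X.a:=\lambda I\,D\,E\,g\,G.\ \exists S\in E.\ a(I,D,E,g,G\langle X\leftarrow S\rangle)$. The translation $\llbracket\cdot\rrbracket$ from MSO formulas to $\sigma$ maps each constructor to the corresponding shallow operation. For $a\in\sigma$, $\models^s a$ means $a(I,D,E,g,G)$ is true for all $I$, $D\subseteq U$, $E\subseteq\mathcal P(U)$, all $g$ with $\mathrm{Range}(g)\subseteq D$ and all $G$ with $\mathrm{Range}(G)\subseteq E$. -}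

module Defs where

open import Data.Bool.Base using (if_then_else_)
open import Data.Nat.Base using (ℕ; _≡ᵇ_)
open import Data.Product.Base using (∃-syntax; _×_)
open import Level using (Level; Lift; suc; _⊔_)
open import Relation.Binary.Core using (Rel)
open import Relation.Binary.PropositionalEquality.Core using (_≡_)
open import Relation.Nullary.Negation.Core using (¬_)
open import Relation.Unary using (Pred; _∈_; _⊆_)

RelSym Var Var₂ : Set
RelSym = ℕ
Var    = ℕ
Var₂   = ℕ

data MSO : Set where
  atom : RelSym → Var → Var → MSO
  mem  : Var₂ → Var → MSO
  neg  : MSO → MSO
  and  : MSO → MSO → MSO
  ex   : Var → MSO → MSO
  ex₂  : Var₂ → MSO → MSO

-- Used for both kinds of assignments, whose variables are natural numbers.
_[_←_] : ∀ {a} {A : Set a} → (ℕ → A) → ℕ → A → (ℕ → A)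
(f [ x ← a ]) y = if y ≡ᵇ x then a else f y

Range : ∀ {a} {A : Set a} → (ℕ → A) → Pred A a
Range f a = ∃[ x ] f x ≡ a

-- Subsets of U are predicates with values in Set ℓ, and sets of subsets are
-- predicates on those with values in Set e.
module Semantics {u} (U : Set u) (ℓ e : Level) where

  𝒫U : Set (u ⊔ suc ℓ)
  𝒫U = Pred U ℓ

  Interp : Set (u ⊔ suc ℓ)
  Interp = RelSym → Rel U ℓ

  -- Truth values are propositions-as-types; no excluded middle is assumed.
  -- The universe must accommodate the quantifiers over D and E, so atomic truth
  -- values have to be lifted into it.
  truth : Level
  truth = u ⊔ suc ℓ ⊔ e

  Truth : Set (suc truth)
  Truth = Set truth

  infix 4 ⟨_⨾_⨾_⟩_⨾_⊨ᵈ_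

  ⟨_⨾_⨾_⟩_⨾_⊨ᵈ_ : Interp → Pred U ℓ → Pred 𝒫U e →
                    (Var → U) → (Var₂ → 𝒫U) → MSO → Truth
  ⟨ I ⨾ D ⨾ E ⟩ g ⨾ G ⊨ᵈ atom r x y = Lift truth (I r (g x) (g y))
  ⟨ I ⨾ D ⨾ E ⟩ g ⨾ G ⊨ᵈ mem X x    = Lift truth (g x ∈ G X)
  ⟨ I ⨾ D ⨾ E ⟩ g ⨾ G ⊨ᵈ neg φ      = ¬ (⟨ I ⨾ D ⨾ E ⟩ g ⨾ G ⊨ᵈ φ)
  ⟨ I ⨾ D ⨾ E ⟩ g ⨾ G ⊨ᵈ and φ ψ    =
    (⟨ I ⨾ D ⨾ E ⟩ g ⨾ G ⊨ᵈ φ) × (⟨ I ⨾ D ⨾ E ⟩ g ⨾ G ⊨ᵈ ψ)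
  ⟨ I ⨾ D ⨾ E ⟩ g ⨾ G ⊨ᵈ ex x φ     =
    ∃[ d ] (d ∈ D × (⟨ I ⨾ D ⨾ E ⟩ g [ x ← d ] ⨾ G ⊨ᵈ φ))
  ⟨ I ⨾ D ⨾ E ⟩ g ⨾ G ⊨ᵈ ex₂ X φ    =
    ∃[ S ] (S ∈ E × (⟨ I ⨾ D ⨾ E ⟩ g ⨾ G [ X ← S ] ⊨ᵈ φ))

  infix 3 ⊨ᵈ_ ⊨ˢ_

  ⊨ᵈ_ : MSO → Set (u ⊔ suc ℓ ⊔ suc e)
  ⊨ᵈ φ = (I : Interp) (D : Pred U ℓ) (E : Pred 𝒫U e)
         (g : Var → U) (G : Var₂ → 𝒫U) →
         Range g ⊆ D → Range G ⊆ E → ⟨ I ⨾ D ⨾ E ⟩ g ⨾ G ⊨ᵈ φ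

  σ : Set (suc truth)
  σ = Interp → Pred U ℓ → Pred 𝒫U e → (Var → U) → (Var₂ → 𝒫U) → Truth

  atomˢ : RelSym → Var → Var → σ
  atomˢ r x y I D E g G = Lift truth (I r (g x) (g y))

  memˢ : Var₂ → Var → σ
  memˢ X x I D E g G = Lift truth (g x ∈ G X)

  negˢ : σ → σ
  negˢ a I D E g G = ¬ a I D E g G

  andˢ : σ → σ → σ
  andˢ a b I D E g G = a I D E g G × b I D E g G

  exˢ : Var → σ → σ
  exˢ x a I D E g G = ∃[ d ] (d ∈ D × a I D E (g [ x ← d ]) G)

  ex₂ˢ : Var₂ → σ → σ
  ex₂ˢ X a I D E g G = ∃[ S ] (S ∈ E × a I D E g (G [ X ← S ]))

  ⟦_⟧ : MSO → σ
  ⟦ atom r x y ⟧ = atomˢ r x y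
  ⟦ mem X x ⟧    = memˢ X x
  ⟦ neg φ ⟧      = negˢ ⟦ φ ⟧
  ⟦ and φ ψ ⟧    = andˢ ⟦ φ ⟧ ⟦ ψ ⟧
  ⟦ ex x φ ⟧     = exˢ x ⟦ φ ⟧
  ⟦ ex₂ X φ ⟧    = ex₂ˢ X ⟦ φ ⟧

  ⊨ˢ_ : σ → Set (u ⊔ suc ℓ ⊔ suc e)
  ⊨ˢ a = (I : Interp) (D : Pred U ℓ) (E : Pred 𝒫U e)
         (g : Var → U) (G : Var₂ → 𝒫U) →
         Range g ⊆ D → Range G ⊆ E → a I D E g G

{-# OPTIONS --safe #-}

-- Each shallow operation is, clause by clause, the deep truth condition of the
-- corresponding constructor, so deep truth and the translation agree at every
-- ⟨I, D, E⟩, g, G by induction on the formula; validity quantifies over the same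
-- arguments on both sides.  Agreement is stated as ⇔ rather than ≡ because
-- equality under the quantifiers would require function extensionality.

module Submission where

open import Defs
open import Level using (Level)
open import Function.Base using (_∘_)
open import Function.Bundles using (_⇔_; mk⇔; Equivalence)
open import Function.Construct.Identity using (⇔-id)
open import Data.Product.Base using (map₂)
open import Data.Product.Function.NonDependent.Propositional using (_×-⇔_)
open import Relation.Unary using (Pred)

module _ {u} {U : Set u} {ℓ e : Level} where

  open Semantics U ℓ e
  open Equivalence using (to; from)

  -- The assignments are generalised after `φ` because the quantifier cases use the induction
  -- hypothesis at `g [ x ← d ]` and `G [ X ← S ]`.
  ⊨ᵈ⇔⟦⟧ : ∀ φ {I : Interp} {D : Pred U ℓ} {E : Pred 𝒫U e}
          {g : Var → U} {G : Var₂ → 𝒫U} →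
          (⟨ I ⨾ D ⨾ E ⟩ g ⨾ G ⊨ᵈ φ) ⇔ ⟦ φ ⟧ I D E g G
  ⊨ᵈ⇔⟦⟧ (atom r x y) = ⇔-id _
  ⊨ᵈ⇔⟦⟧ (mem X x)    = ⇔-id _
  -- Negation is contravariant, so each direction consumes the opposite one for `φ`; both must be
  -- proved together.
  ⊨ᵈ⇔⟦⟧ (neg φ)      = mk⇔ (_∘ from (⊨ᵈ⇔⟦⟧ φ)) (_∘ to (⊨ᵈ⇔⟦⟧ φ))
  ⊨ᵈ⇔⟦⟧ (and φ ψ)    = ⊨ᵈ⇔⟦⟧ φ ×-⇔ ⊨ᵈ⇔⟦⟧ ψ
  -- The witness and its membership in the domain are kept; only the truth of the body is
  -- transported.
  ⊨ᵈ⇔⟦⟧ (ex x φ)     = mk⇔ (map₂ (map₂ (to (⊨ᵈ⇔⟦⟧ φ)))) (map₂ (map₂ (from (⊨ᵈ⇔⟦⟧ φ))))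
  ⊨ᵈ⇔⟦⟧ (ex₂ X φ)    = mk⇔ (map₂ (map₂ (to (⊨ᵈ⇔⟦⟧ φ)))) (map₂ (map₂ (from (⊨ᵈ⇔⟦⟧ φ))))

mainTheorem6 : ∀ {u} (ℓ e : Level) (U : Set u) → U → (φ : MSO) →
    let open Semantics U ℓ e in (⊨ᵈ φ) ⇔ (⊨ˢ ⟦ φ ⟧)
mainTheorem6 ℓ e U _ φ = mk⇔
  (λ valid I D E g G g⊆D G⊆E → Equivalence.to   (⊨ᵈ⇔⟦⟧ φ) (valid I D E g G g⊆D G⊆E))
  (λ valid I D E g G g⊆D G⊆E → Equivalence.from (⊨ᵈ⇔⟦⟧ φ) (valid I D E g G g⊆D G⊆E))
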